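{- Let $k\ge 1$ be an integer. If $T$ is a tree and if $\mathcal{T}$ is a $k$-Helly collection of leaf-cuttable subtrees of $T$, then there exists a set $E$ of at most $k-1$ edges of $T$ such that every $T_i\in\mathcal{T}$ contains at least one edge of $E$.
   Context: Graphs are finite and simple. Given a tree $T$, a subgraph $T'\subseteq T$ is a subtree of $T$ if $T'$ is itself a tree. A leaf of a tree is a vertex of degree $1$ in it. A subtree $T'$ of $T$ is leaf-cuttable if it has at least one edge and if every edge in $E(T)\setminus E(T')$ which is incident to a vertex of $T'$ is incident to a leaf of $T'$. A collection $\mathcal{T}$ of subtrees of $T$ is $k$-Helly if for any $T_1,\ldots,T_k\in\mathcal{T}$ there exist some $i\ne j$ with $E(T_i)\cap E(T_j)\ne\emptyset$; by convention, $\mathcal{T}$ is $1$-Helly if and only if $\mathcal{T}=\emptyset$. -}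

module Defs where

open import Data.Bool.Base using (Bool; T)
open import Data.Fin.Base using (Fin; zero)
open import Data.Fin.Subset using (Subset; _∈_; _⊆_; ∣_∣; Nonempty)
open import Data.List.Base using (List; []; _∷_; [_]; _++_; length)
open import Data.List.Membership.Propositional using () renaming (_∈_ to _∈ˡ_)
open import Data.List.Relation.Unary.Any using (here)
open import Data.List.Relation.Unary.Linked using (Linked)
open import Data.List.Relation.Unary.Unique.Propositional using (Unique)
open import Data.Nat.Base using (ℕ; _≤_)
open import Data.Product.Base using (_×_; _,_; ∃; ∃-syntax; ∃₂)
open import Data.Sum.Base using (_⊎_)
open import Data.Vec.Base using (tabulate)
open import Function.Bundles using (_⇔_; mk⇔)
open import Level using (0ℓ)
open import Relation.Binary.Core using (Rel)
open import Relation.Binary.Construct.Closure.ReflexiveTransitive using (Star)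
open import Relation.Binary.Definitions using (Symmetric; Irreflexive)
open import Relation.Binary.PropositionalEquality using (_≡_; _≢_; refl)
open import Relation.Nullary using (¬_; contradiction)

private
  variable
    n : ℕ

-- The vertex set is a subset of Fin n rather than all of it, so that a graph
-- and its subgraphs have the same type and share the notions below.
record Graph (n : ℕ) : Set where
  field
    V   : Subset n
    adj : Fin n → Fin n → Bool

  Adj : Rel (Fin n) 0ℓ
  Adj u v = T (adj u v)

  field
    adj-sym    : Symmetric Adj
    adj-irrefl : Irreflexive _≡_ Adj
    adj⇒∈V     : ∀ {u v} → Adj u v → u ∈ V

  degree : Fin n → ℕ
  degree v = ∣ tabulate (adj v) ∣

open Graph public

Connected : Graph n → Set
Connected G = Nonempty (V G) × (∀ {u v} → u ∈ V G → v ∈ V G → Star (Adj G) u v)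

-- The cycle is x, then the vertices of xs in order, then back to x.
IsCycle : Graph n → Fin n → List (Fin n) → Set
IsCycle G x xs =
  3 ≤ length (x ∷ xs) × Unique (x ∷ xs) × Linked (Adj G) (x ∷ xs ++ [ x ])

Acyclic : Graph n → Set
Acyclic G = ∀ x xs → ¬ IsCycle G x xs

IsTree : Graph n → Set
IsTree G = Connected G × Acyclic G

infix 4 _⊆ᵍ_ _∈ᴱ_

_⊆ᵍ_ : Graph n → Graph n → Set
H ⊆ᵍ G = V H ⊆ V G × (∀ {u v} → Adj H u v → Adj G u v)

IsSubtree : Graph n → Graph n → Set
IsSubtree G H = H ⊆ᵍ G × IsTree H

IsLeaf : Graph n → Fin n → Set
IsLeaf G v = v ∈ V G × degree G v ≡ 1

Incident : Fin n → Fin n → Fin n → Set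
Incident w u v = w ≡ u ⊎ w ≡ v

LeafCuttable : Graph n → Graph n → Set
LeafCuttable G H =
  IsSubtree G H ×
  (∃₂ λ u v → Adj H u v) ×
  (∀ u v → Adj G u v → ¬ Adj H u v →
     (∃[ w ] w ∈ V H × Incident w u v) →
     (∃[ w ] IsLeaf H w × Incident w u v))

ShareEdge : Graph n → Graph n → Set
ShareEdge G H = ∃₂ λ u v → Adj G u v × Adj H u v

-- The k members need not be distinct.  Collections of subgraphs of a finite
-- graph are finite, and are given by lists; the order of a list and
-- repetitions in it play no role.
Helly : ℕ → List (Graph n) → Set
Helly {n} k 𝒯 =
  (S : Fin k → Graph n) → (∀ i → S i ∈ˡ 𝒯) →
  ∃₂ λ i j → i ≢ j × ShareEdge (S i) (S j)

-- The convention for k = 1 is an instance of the general definition.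
Helly-1 : (𝒯 : List (Graph n)) → Helly 1 𝒯 ⇔ 𝒯 ≡ []
Helly-1 𝒯 = mk⇔ (to 𝒯) from
  where
  to : ∀ 𝒯 → Helly 1 𝒯 → 𝒯 ≡ []
  to []      _ = refl
  to (H ∷ _) h with h (λ _ → H) (λ _ → here refl)
  ... | zero , zero , 0≢0 , _ = contradiction refl 0≢0

  from : 𝒯 ≡ [] → Helly 1 𝒯
  from refl S S∈ with () ← S∈ zero

-- An edge is given by its two ends in either order, and a set of at most m
-- edges by a list of length at most m.
_∈ᴱ_ : Fin n × Fin n → Graph n → Set
(u , v) ∈ᴱ G = Adj G u v

{-# OPTIONS --safe #-}
-- Root T at a vertex r of degree at most 1.  The vertex p of a leaf-cuttable
-- subtree H nearest to r has a single neighbour c in H: this is clear if p = r,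
-- and otherwise the edge from p towards r lies outside H, so that p is a leaf
-- of H.  Hence every edge of H is joined to the "top edge" pc by a path in H
-- climbing towards r.  If H and K share an edge and the top edge of H is at
-- least as deep as that of K, climbing from the shared edge shows that K
-- contains the top edge of H.  So going through the collection from the deepest
-- top edge to the shallowest, and selecting the members which contain no
-- earlier selected top edge, gives pairwise edge-disjoint members whose top
-- edges meet all of 𝒯; a k-Helly collection has at most k − 1 such members.
module Submission where

open import Data.Bool.Properties using (T?; T-≡)
open import Data.Fin.Base using (Fin; zero; suc; inject≤)
open import Data.Fin.Properties using (inject≤-injective) renaming (_≟_ to _≟ᶠ_)
open import Data.Fin.Subset using (Subset; _∈_; ∣_∣; Nonempty; _-_)
open import Data.Fin.Subset.Properties
  using (_∈?_; x∈p∧x≢y⇒x∈p-y; x∈p⇒∣p-x∣<∣p∣)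
open import Data.List.Base using (List; []; _∷_; [_]; _++_; length; map; allFin; filter; lookup)
open import Data.List.Extrema.Nat
  using (argmin; argmax; argmin-all; argmax-all; f[argmin]≤f[xs]; f[xs]≤f[argmax])
open import Data.List.Membership.DecPropositional using () renaming (_∈?_ to ∈?ˡ)
open import Data.List.Membership.Propositional using () renaming (_∈_ to _∈ˡ_)
open import Data.List.Membership.Propositional.Properties
  using (∈-allFin; ∈-filter⁺; ∈-lookup; ∈-map⁺)
open import Data.List.Properties using (length-map; ∷-injectiveʳ)
open import Data.List.Relation.Binary.Permutation.Propositional.Properties
  using (All-resp-↭; ∈-resp-↭)
open import Data.List.Relation.Unary.All as All using (All; []; _∷_)
open import Data.List.Relation.Unary.All.Properties as All using (all-filter; ¬Any⇒All¬)
open import Data.List.Relation.Unary.AllPairs using (AllPairs; []; _∷_)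
open import Data.List.Relation.Unary.Any as Any using (Any; here; there)
import Data.List.Relation.Unary.Any.Properties as Any
open import Data.List.Relation.Unary.Linked using (Linked; [-]; _∷_)
open import Data.List.Relation.Unary.Sorted.TotalOrder.Properties using (Sorted⇒AllPairs)
open import Data.List.Relation.Unary.Unique.Propositional using (Unique)
import Data.List.Sort
open import Data.Nat.Base using (ℕ; suc; _≤_; _<_; _∸_; z≤n; s≤s)
open import Data.Nat.Properties
  using (≤-refl; ≤-reflexive; ≤-trans; <-≤-trans; n≤1+n; n≮0; 1+n≰n; m≢1+n+m; <⇒≤pred;
         ≰⇒>; ≤-decTotalOrder)
open import Data.Product.Base using (_×_; _,_; ∃; ∃-syntax; proj₁; proj₂)
open import Data.Sum.Base using (_⊎_; inj₁; inj₂; [_,_]′)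
open import Data.Vec.Base using (tabulate)
open import Data.Vec.Properties using (lookup⇒[]=; lookup∘tabulate)
open import Function.Base using (_∘_; _on_)
open import Function.Bundles using (Equivalence)
open import Level using (0ℓ)
open import Relation.Binary.Bundles using (DecTotalOrder)
open import Relation.Binary.Construct.Closure.ReflexiveTransitive using (Star; ε; _◅_; _◅◅_; reverse)
import Relation.Binary.Construct.On as On
open import Relation.Binary.Core using (Rel; _⇒_)
open import Relation.Binary.Definitions using (Symmetric)
open import Relation.Binary.PropositionalEquality
  using (_≡_; _≢_; refl; sym; trans; cong; subst; ≢-sym)
open import Relation.Nullary using (¬_; yes; no; contradiction)
open import Defs

private
  variable
    n : ℕ
    R S : Rel (Fin n) 0ℓ
    u v w x y z : Fin n
    xs ys : List (Fin n)

-- Finite sets and lists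

argmin-∈ : {S : Subset n} → Nonempty S → (f : Fin n → ℕ) →
  ∃[ x ] x ∈ S × (∀ {y} → y ∈ S → f x ≤ f y)
argmin-∈ {S = S} (x₀ , x₀∈S) f =
  argmin f x₀ elems , argmin-all f x₀∈S (all-filter (_∈? S) (allFin _)) ,
  λ {y} y∈S → All.lookup (f[argmin]≤f[xs] x₀ elems) (∈-filter⁺ (_∈? S) (∈-allFin y) y∈S)
  where elems = filter (_∈? S) (allFin _)

argmax-∈ : {S : Subset n} → Nonempty S → (f : Fin n → ℕ) →
  ∃[ x ] x ∈ S × (∀ {y} → y ∈ S → f y ≤ f x)
argmax-∈ {S = S} (x₀ , x₀∈S) f =
  argmax f x₀ elems , argmax-all f x₀∈S (all-filter (_∈? S) (allFin _)) ,
  λ {y} y∈S → All.lookup (f[xs]≤f[argmax] x₀ elems) (∈-filter⁺ (_∈? S) (∈-allFin y) y∈S)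
  where elems = filter (_∈? S) (allFin _)

-- Distinct `x` and `y` could be removed one after the other, each removal lowering a size that is
-- at most 1.
∣p∣≤1⇒unique : {p : Subset n} → ∣ p ∣ ≤ 1 → x ∈ p → y ∈ p → x ≡ y
∣p∣≤1⇒unique {x = x} {y} ∣p∣≤1 x∈p y∈p with x ≟ᶠ y
... | yes x≡y = x≡y
... | no  x≢y = contradiction
  (<-≤-trans (x∈p⇒∣p-x∣<∣p∣ (x∈p∧x≢y⇒x∈p-y y∈p (≢-sym x≢y)))
             (<⇒≤pred (<-≤-trans (x∈p⇒∣p-x∣<∣p∣ x∈p) ∣p∣≤1)))
  n≮0

AllPairs-lookup : ∀ {a ℓ} {A : Set a} {_~_ : Rel A ℓ} → Symmetric _~_ →
  {xs : List A} → AllPairs _~_ xs → ∀ {i j} → i ≢ j → lookup xs i ~ lookup xs j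
AllPairs-lookup s (_  ∷ _)   {zero}  {zero}  i≢j = contradiction refl i≢j
AllPairs-lookup s (px ∷ _)   {zero}  {suc j} i≢j = All.lookup px (∈-lookup j)
AllPairs-lookup s (px ∷ _)   {suc i} {zero}  i≢j = s (All.lookup px (∈-lookup i))
AllPairs-lookup s (_  ∷ pxs) {suc i} {suc j} i≢j = AllPairs-lookup s pxs (i≢j ∘ cong suc)

-- Simple paths

-- The list consists of all the vertices of the path, including both ends.
data Path (R : Rel (Fin n) 0ℓ) : (x y : Fin n) → List (Fin n) → Set where
  stop : x ≡ y → Path R x y [ x ]
  step : R x z → All (x ≢_) xs → Path R z y xs → Path R x y (x ∷ xs)

Path-map : R ⇒ S → Path R x y xs → Path S x y xs
Path-map f (stop eq)       = stop eq
Path-map f (step r x∉xs p) = step (f r) x∉xs (Path-map f p)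

Path-end : Path R x y xs → y ∈ˡ xs
Path-end (stop eq)     = here (sym eq)
Path-end (step _ _ p)  = there (Path-end p)

Path-unique : Path R x y xs → Unique xs
Path-unique (stop _)        = [] ∷ []
Path-unique (step _ x∉xs p) = x∉xs ∷ Path-unique p

Path-start : Path R x y xs → Path S z w xs → x ≡ z
Path-start (stop _)     (stop _)     = refl
Path-start (stop _)     (step _ _ ())
Path-start (step _ _ _) (stop _)     = refl
Path-start (step _ _ _) (step _ _ _) = refl

Path-suffix : Path R x y xs → z ∈ˡ xs →
  ∃[ ys ] Path R z y ys × (∀ {w} → w ∈ˡ ys → w ∈ˡ xs)
Path-suffix p@(stop _)     (here refl) = _ , p , λ w∈ → w∈
Path-suffix p@(step _ _ _) (here refl) = _ , p , λ w∈ → w∈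
Path-suffix (step _ _ p)   (there z∈)  with Path-suffix p z∈
... | _ , q , sub = _ , q , there ∘ sub

Path⇒Star : Path R x y xs → Star R x y
Path⇒Star (stop refl)  = ε
Path⇒Star (step r _ p) = r ◅ Path⇒Star p

-- Loop erasure: if `x` already lies on the path found for the rest of the walk, only the part from
-- that occurrence on is kept.
Star⇒Path : Star R x y → ∃[ xs ] Path R x y xs
Star⇒Path ε = _ , stop refl
Star⇒Path {x = x} (r ◅ rs) with Star⇒Path rs
... | xs , p with ∈?ˡ _≟ᶠ_ x xs
...   | yes x∈xs = _ , proj₁ (proj₂ (Path-suffix p x∈xs))
...   | no  x∉xs = _ , step r (¬Any⇒All¬ xs x∉xs) p

Path-linked : R u x → Path R x y xs → R y v → Linked R (u ∷ xs ++ [ v ])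
Path-linked r (stop refl)   s = r ∷ s ∷ [-]
Path-linked r (step r′ _ p) s = r ∷ Path-linked r′ p s

module _ (G : Graph n) where

  Avoiding : Fin n → Rel (Fin n) 0ℓ
  Avoiding v x y = Adj G x y × v ≢ x × v ≢ y

  Avoiding-sym : Symmetric (Avoiding v)
  Avoiding-sym (a , v≢x , v≢y) = adj-sym G a , v≢y , v≢x

  Path-avoids : v ≢ x → Path (Avoiding v) x y xs → All (v ≢_) xs
  Path-avoids v≢x (stop _)                  = v≢x ∷ []
  Path-avoids v≢x (step (_ , _ , v≢z) _ p)  = v≢x ∷ Path-avoids v≢z p

  Path⇒Avoiding : All (v ≢_) xs → Path (Adj G) x y xs → Path (Avoiding v) x y xs
  Path⇒Avoiding _            (stop eq)                      = stop eq
  -- Matching on `p` exposes the next vertex as the head of the list, which is what `All.head`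
  -- needs.
  Path⇒Avoiding (v≢x ∷ v∉xs) (step a x∉xs p@(stop _))       =
    step (a , v≢x , All.head v∉xs) x∉xs (Path⇒Avoiding v∉xs p)
  Path⇒Avoiding (v≢x ∷ v∉xs) (step a x∉xs p@(step _ _ _))   =
    step (a , v≢x , All.head v∉xs) x∉xs (Path⇒Avoiding v∉xs p)

  module _ (acyclic : Acyclic G) where

    -- A simple path of positive length between two neighbours of `v` that avoids `v` closes up
    -- through `v` to a cycle.
    neighbours-joined⇒≡ : Adj G v x → Adj G v y → v ≢ x → Star (Avoiding v) x y → x ≡ y
    neighbours-joined⇒≡ {v = v} vx vy v≢x walk with Star⇒Path walk
    ... | _ , stop x≡y = x≡y
    ... | xs , p@(step _ _ q) = contradiction
      ( s≤s (s≤s (nonempty q))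
      , Path-avoids v≢x p ∷ Path-unique p
      , Path-linked vx (Path-map proj₁ p) (adj-sym G vy))
      (acyclic v xs)
      where
      nonempty : ∀ {R : Rel (Fin n) 0ℓ} {x y xs} → Path R x y xs → 1 ≤ length xs
      nonempty (stop _)     = s≤s z≤n
      nonempty (step _ _ _) = s≤s z≤n

    -- Both tails avoid `x` and end at `y`, so together they join the two second vertices around
    -- `x`. These are neighbours of `x`, hence equal, and the tails are compared in turn.
    simple-path-unique : Path (Adj G) x y xs → Path (Adj G) x y ys → xs ≡ ys
    simple-path-unique (stop _) (stop _) = refl
    simple-path-unique (stop x≡y) (step _ x∉ q) =
      contradiction x≡y (All.lookup x∉ (Path-end q))
    simple-path-unique (step _ x∉ p) (stop x≡y) =
      contradiction x≡y (All.lookup x∉ (Path-end p))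
    simple-path-unique {x = x} (step a x∉ p) (step b x∉′ q)
      with refl ← neighbours-joined⇒≡ a b (λ { refl → adj-irrefl G refl a })
                    (Path⇒Star (Path⇒Avoiding x∉ p) ◅◅
                     reverse Avoiding-sym (Path⇒Star (Path⇒Avoiding x∉′ q)))
      = cong (x ∷_) (simple-path-unique p q)

-- Rooted trees

adj⇒∈Vʳ : (G : Graph n) → Adj G u v → v ∈ V G
adj⇒∈Vʳ G a = adj⇒∈V G (adj-sym G a)

-- Having at most one neighbour, unlike being a leaf, passes to subgraphs and is possible in a tree
-- with one vertex.
Pendant : Graph n → Fin n → Set
Pendant G v = ∀ {x y} → Adj G v x → Adj G v y → x ≡ y

IsLeaf⇒Pendant : (G : Graph n) → IsLeaf G v → Pendant G v
IsLeaf⇒Pendant {v = v} G (_ , deg≡1) vx vy =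
  ∣p∣≤1⇒unique (≤-reflexive deg≡1) (neighbour vx) (neighbour vy)
  where
  neighbour : ∀ {x} → Adj G v x → x ∈ tabulate (adj G v)
  neighbour {x} vx = lookup⇒[]= x _
    (trans (lookup∘tabulate (adj G v) x) (Equivalence.to T-≡ vx))

-- Up G d y x says that x is the parent of y, for the depth function d.
Up : Graph n → (Fin n → ℕ) → Rel (Fin n) 0ℓ
Up G d y x = Adj G x y × d y ≡ suc (d x)

record Rooting (G : Graph n) (root : Fin n) : Set where
  field
    depth         : Fin n → ℕ
    adj⇒up        : Adj G u v → Up G depth v u ⊎ Up G depth u v
    parent-unique : Up G depth v x → Up G depth v y → x ≡ y
    parent        : v ∈ V G → v ≡ root ⊎ ∃ (Up G depth v)

tree-rooting : (G : Graph n) → IsTree G → ∀ {r} → r ∈ V G → Rooting G r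
tree-rooting {n} G ((_ , connected) , acyclic) {r} r∈V = record
  { depth         = depth
  ; adj⇒up        = λ a → [ (λ eq → inj₁ (a , cong length eq))
                          , (λ eq → inj₂ (adj-sym G a , cong length eq)) ]′ (spine-step a)
  ; parent-unique = λ (xv , dx) (yv , dy) →
      -- Either parent has as spine that of the child without its head, and a spine starts at its
      -- own vertex.
      let eq = ∷-injectiveʳ (trans (sym (spine-up xv dx)) (spine-up yv dy))
      in Path-start (spine-path (adj⇒∈V G xv))
                    (subst (Path _ _ _) (sym eq) (spine-path (adj⇒∈V G yv)))
  ; parent        = λ v∈V → parent (spine-path v∈V) refl
  }
  where
  spine : Fin n → List (Fin n)
  spine v with v ∈? V G
  ... | yes v∈V = proj₁ (Star⇒Path (connected v∈V r∈V))
  -- A default outside the tree.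
  ... | no  _   = []

  spine-path : ∀ {v} → v ∈ V G → Path (Adj G) v r (spine v)
  spine-path {v} v∈V with v ∈? V G
  ... | yes v∈V′ = proj₂ (Star⇒Path (connected v∈V′ r∈V))
  ... | no  v∉V  = contradiction v∈V v∉V

  -- Vertices are counted, not edges, so the root has depth 1.
  depth : Fin n → ℕ
  depth v = length (spine v)

  spine-unique : ∀ {v xs} → Path (Adj G) v r xs → v ∈ V G → spine v ≡ xs
  spine-unique p v∈V = simple-path-unique G acyclic (spine-path v∈V) p

  extend : ∀ {u v} → Adj G u v → All (u ≢_) (spine v) → spine u ≡ u ∷ spine v
  extend a u∉ = spine-unique (step a u∉ (spine-path (adj⇒∈Vʳ G a))) (adj⇒∈V G a)

  -- If `v` lies on the spine of `u`, the part from `v` on is the spine of `v` by uniqueness. It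
  -- misses `u`, which occurs only at the start, so the spine of `v` can be extended by `u`.
  spine-step : ∀ {u v} → Adj G u v → spine v ≡ v ∷ spine u ⊎ spine u ≡ u ∷ spine v
  spine-step {u} {v} a with ∈?ˡ _≟ᶠ_ v (spine u)
  ... | no  v∉ = inj₁ (extend (adj-sym G a) (¬Any⇒All¬ _ v∉))
  ... | yes v∈ = inj₂ (extend a (¬Any⇒All¬ _ (u∉ (spine-path (adj⇒∈V G a)) v∈)))
    where
    u∉ : ∀ {xs} → Path (Adj G) u r xs → v ∈ˡ xs → ¬ u ∈ˡ spine v
    u∉ (stop _)        (here refl) _ = adj-irrefl G refl a
    u∉ (step _ _ _)    (here refl) _ = adj-irrefl G refl a
    u∉ (step _ u∉xs p) (there v∈)  u∈ with Path-suffix p v∈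
    ... | ys , q , ys⊆xs
      rewrite spine-unique q (adj⇒∈Vʳ G a) = All.lookup u∉xs (ys⊆xs u∈) refl

  spine-up : ∀ {u v} → Adj G u v → depth v ≡ suc (depth u) → spine v ≡ v ∷ spine u
  spine-up a dv with spine-step a
  ... | inj₁ eq = eq
  ... | inj₂ eq = contradiction (trans dv (cong suc (cong length eq))) (m≢1+n+m _)

  parent : ∀ {v xs} → Path (Adj G) v r xs → spine v ≡ xs → v ≡ r ⊎ ∃ (Up G depth v)
  parent (stop v≡r)    _  = inj₁ v≡r
  parent (step a _ p)  eq = inj₂ (_ , adj-sym G a ,
    trans (cong length eq) (cong (suc ∘ length) (sym (spine-unique p (adj⇒∈Vʳ G a)))))

-- A vertex of largest depth for an arbitrary root is pendant.
pendant-rooting : (G : Graph n) → IsTree G → ∃[ r ] Pendant G r × Rooting G r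
pendant-rooting G tree@((nonempty@(_ , r₀∈V) , _) , _)
  with r , r∈V , deepest ← argmax-∈ nonempty (Rooting.depth (tree-rooting G tree r₀∈V))
  = r , (λ rx ry → parent-unique (up rx) (up ry)) , tree-rooting G tree r∈V
  where
  open Rooting (tree-rooting G tree r₀∈V)

  up : ∀ {x} → Adj G r x → Up G depth r x
  up rx with adj⇒up rx
  ... | inj₂ xr       = xr
  ... | inj₁ (_ , dx) =
    contradiction (subst (_≤ depth r) dx (deepest (adj⇒∈Vʳ G rx))) 1+n≰n

-- Top edges of leaf-cuttable subtrees

module Rooted {G : Graph n} {r : Fin n} (pendant : Pendant G r) (rooting : Rooting G r) where
  open Rooting rooting

  -- The lower end of an edge determines it, so a path climbing from b to c in H
  -- relates the edges of which b and c are the lower ends.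
  record Top (H : Graph n) : Set where
    field
      sub   : H ⊆ᵍ G
      p c   : Fin n
      top   : Up H depth c p
      climb : ∀ {a b} → Up H depth b a → Star (Up H depth) b c

  open Top

  subgraph-up : ∀ H → H ⊆ᵍ G → Up H depth v u → Up G depth v u
  subgraph-up H H⊆G (a , d) = proj₂ H⊆G a , d

  adj⇒upˢ : ∀ H → H ⊆ᵍ G → Adj H u v → Up H depth v u ⊎ Up H depth u v
  adj⇒upˢ H H⊆G a with adj⇒up (proj₂ H⊆G a)
  ... | inj₁ (_ , d) = inj₁ (a , d)
  ... | inj₂ (_ , d) = inj₂ (adj-sym H a , d)

  leafCuttable⇒Top : ∀ {H} → LeafCuttable G H → Top H
  leafCuttable⇒Top {H} ((H⊆G , (nonempty , connected) , _) , (x₀ , y₀ , x₀y₀) , cut)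
    with p , p∈V , highest ← argmin-∈ nonempty depth
    = record { sub = H⊆G ; p = p ; c = proj₁ child ; top = down (proj₂ child) ; climb = climb′ }
    where
    not-up : ∀ {x} → x ∈ V H → ¬ depth p ≡ suc (depth x)
    not-up x∈V dp = 1+n≰n (subst (_≤ depth _) dp (highest x∈V))

    down : ∀ {x} → Adj H p x → Up H depth x p
    down px with adj⇒upˢ H H⊆G px
    ... | inj₁ up       = up
    ... | inj₂ (_ , dp) = contradiction dp (not-up (adj⇒∈Vʳ H px))

    first : ∀ {x} → p ≢ x → Star (Adj H) p x → ∃ (Adj H p)
    first p≢x ε         = contradiction refl p≢x
    first p≢x (px ◅ _)  = _ , px

    child : ∃ (Adj H p)
    child with p ≟ᶠ x₀
    ... | yes refl = y₀ , x₀y₀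
    ... | no  p≢x₀ = first p≢x₀ (connected p∈V (adj⇒∈V H x₀y₀))

    pendantᴴ : Pendant H p
    pendantᴴ with parent (proj₁ H⊆G p∈V)
    ... | inj₁ refl = λ px py → pendant (proj₂ H⊆G px) (proj₂ H⊆G py)
    ... | inj₂ (q , qp , dp)
      -- The parent `q` of `p` is shallower than every vertex of `H`, hence not in `H`; so the leaf
      -- at the edge `qp` must be `p`.
      with cut q p qp (λ qp′ → not-up (adj⇒∈V H qp′) dp) (p , p∈V , inj₂ refl)
    ...   | _ , leaf , inj₁ refl = contradiction dp (not-up (proj₁ leaf))
    ...   | _ , leaf , inj₂ refl = IsLeaf⇒Pendant H leaf

    -- An invariant of walks in `H` that start at `p`; since `H` is connected, it reaches all
    -- vertices of `H`.
    Climbs : Fin n → Set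
    Climbs x = x ≡ p ⊎ Star (Up H depth) x (proj₁ child)

    climbs-step : ∀ {x y} → Adj H x y → Climbs x → Climbs y
    climbs-step px (inj₁ refl) with refl ← pendantᴴ px (proj₂ child) = inj₂ ε
    climbs-step xy (inj₂ s) with adj⇒upˢ H H⊆G xy
    ... | inj₁ up = inj₂ (up ◅ s)
    -- The walk moves to the parent of `x`. This is `p` if the climb from `x` is already over, and
    -- otherwise the next vertex of that climb.
    ... | inj₂ up with s
    ...   | ε = inj₁ (parent-unique (subgraph-up H H⊆G up)
                                    (subgraph-up H H⊆G (down (proj₂ child))))
    ...   | up′ ◅ s′
      with refl ← parent-unique (subgraph-up H H⊆G up) (subgraph-up H H⊆G up′) = inj₂ s′

    climbs-walk : ∀ {x y} → Star (Adj H) x y → Climbs x → Climbs y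
    climbs-walk ε        cx = cx
    climbs-walk (a ◅ as) cx = climbs-walk as (climbs-step a cx)

    climb′ : ∀ {a b} → Up H depth b a → Star (Up H depth) b (proj₁ child)
    climb′ (ab , db) with climbs-walk (connected p∈V (adj⇒∈Vʳ H ab)) (inj₁ refl)
    ... | inj₁ refl = contradiction db (not-up (adj⇒∈V H ab))
    ... | inj₂ s    = s

  climb-shallower : ∀ H → Star (Up H depth) x y → depth y ≤ depth x
  climb-shallower H ε              = ≤-refl
  climb-shallower H ((_ , d) ◅ s)  =
    ≤-trans (climb-shallower H s) (≤-trans (n≤1+n _) (≤-reflexive (sym d)))

  -- By uniqueness of parents the climbs from `v` in `H` and in `K` coincide while both last. The
  -- one in `K` ends no deeper, so it passes through `c t`; the edge from there to the parent is
  -- either its next step or the top edge of `K`.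
  contains-top-of-deeper : ∀ {H K} (t : Top H) (s : Top K) → depth (c s) ≤ depth (c t) →
    Up H depth v u → Adj K u v → Adj K (p t) (c t)
  contains-top-of-deeper {H = H} {K} t s cs≤ct vu uvK =
    parent-edge (meet (climb t vu) (climb s (uvK , proj₂ vu))) (subgraph-up H (sub t) (top t))
    where
    meet : ∀ {b} → Star (Up H depth) b (c t) → Star (Up K depth) b (c s) →
           Star (Up K depth) (c t) (c s)
    meet ε              ys = ys
    -- Were the climb in `K` to stop first, `c t` would be strictly shallower than `c s`.
    meet ((_ , d) ◅ xs) ε  = contradiction
      (≤-trans (s≤s (climb-shallower H xs)) (≤-trans (≤-reflexive (sym d)) cs≤ct)) 1+n≰n
    meet (x ◅ xs) (y ◅ ys)
      with refl ← parent-unique (subgraph-up H (sub t) x) (subgraph-up K (sub s) y) =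
      meet xs ys

    parent-edge : ∀ {x q} → Star (Up K depth) x (c s) → Up G depth x q → Adj K q x
    parent-edge ε up
      with refl ← parent-unique up (subgraph-up K (sub s) (top s)) = proj₁ (top s)
    parent-edge (y ◅ _) up
      with refl ← parent-unique up (subgraph-up K (sub s) y) = proj₁ y

  shares⇒contains-top : ∀ {H K} (t : Top H) (s : Top K) → depth (c s) ≤ depth (c t) →
    ShareEdge H K → Adj K (p t) (c t)
  shares⇒contains-top {H} {K} t s cs≤ct (u , v , uvH , uvK) with adj⇒upˢ H (sub t) uvH
  ... | inj₁ vu = contains-top-of-deeper t s cs≤ct vu uvK
  ... | inj₂ uv = contains-top-of-deeper t s cs≤ct uv (adj-sym K uvK)

  -- Greedy selection of edge-disjoint members

  Topped : Set
  Topped = ∃ Top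

  topEdge : Topped → Fin n × Fin n
  topEdge (_ , t) = p t , c t

  level : Topped → ℕ
  level (_ , t) = depth (c t)

  Disjoint : Rel Topped 0ℓ
  Disjoint (H , _) (K , _) = ¬ ShareEdge H K

  record HittingPacking (ts : List Topped) : Set where
    field
      picks    : List Topped
      picks⊆   : All (_∈ˡ ts) picks
      disjoint : AllPairs Disjoint picks
      hit      : All (λ t → Any (λ s → topEdge s ∈ᴱ proj₁ t) picks) ts

  -- The order is from shallow to deep, so the recursion treats the tail first and every pick made
  -- before `t` is at least as deep as `t`.
  hittingPacking : ∀ {ts} → AllPairs (_≤_ on level) ts → HittingPacking ts
  hittingPacking [] = record { picks = [] ; picks⊆ = [] ; disjoint = [] ; hit = [] }
  hittingPacking {(H , t) ∷ ts} (shallowest ∷ sorted)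
    with record { picks = picks ; picks⊆ = picks⊆ ; disjoint = disjoint ; hit = hit }
           ← hittingPacking sorted
    with Any.any? (λ s → T? (adj H (proj₁ (topEdge s)) (proj₂ (topEdge s)))) picks
  ... | yes t-hit = record
    { picks    = picks
    ; picks⊆   = All.map there picks⊆
    ; disjoint = disjoint
    ; hit      = t-hit ∷ hit
    }
  ... | no ¬t-hit = record
    { picks    = (H , t) ∷ picks
    ; picks⊆   = here refl ∷ All.map there picks⊆
    ; disjoint = All.zipWith
        -- A pick sharing an edge with `H` would have its top edge in `H`, against the failed test.
        (λ { {_ , s} (s∈ts , ¬contains) (u , v , uvH , uvK) → ¬contains
               (shares⇒contains-top s t (All.lookup shallowest s∈ts) (u , v , uvK , uvH)) })
        (picks⊆ , ¬Any⇒All¬ picks ¬t-hit) ∷ disjoint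
    ; hit      = here (proj₁ (top t)) ∷ All.map there hit
    }

  levelOrder : DecTotalOrder 0ℓ 0ℓ 0ℓ
  levelOrder = On.decTotalOrder ≤-decTotalOrder level

  open Data.List.Sort levelOrder using (sort; sort-↭; sort-↗)

  sortedHittingPacking : (ts : List Topped) → HittingPacking ts
  sortedHittingPacking ts = record
    { picks    = picks
    ; picks⊆   = All.map (∈-resp-↭ (sort-↭ ts)) picks⊆
    ; disjoint = disjoint
    ; hit      = All-resp-↭ (sort-↭ ts) hit
    }
    where
    open HittingPacking
      (hittingPacking (Sorted⇒AllPairs (DecTotalOrder.totalOrder levelOrder) (sort-↗ ts)))

  -- Otherwise the first `k` entries of `ts` would be a family violating `Helly k`.
  disjoint⇒<k : ∀ {k 𝒯 ts} → Helly k 𝒯 → All (λ t → proj₁ t ∈ˡ 𝒯) ts → AllPairs Disjoint ts →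
    length ts < k
  disjoint⇒<k {k} {ts = ts} helly ts⊆𝒯 disjoint = ≰⇒> λ k≤ →
    let i , j , i≢j , share = helly (λ i → proj₁ (lookup ts (inject≤ i k≤)))
                                    (λ i → All.lookup ts⊆𝒯 (∈-lookup (inject≤ i k≤)))
    in AllPairs-lookup (λ { ¬s (u , v , a , b) → ¬s (u , v , b , a) }) disjoint
         (i≢j ∘ inject≤-injective k≤ k≤ i j) share

-- Brings results about the members paired with their top edges back to the given collection.
map-proj₁-toList : ∀ {a p} {A : Set a} {P : A → Set p} {xs : List A} (pxs : All P xs) →
  map proj₁ (All.toList pxs) ≡ xs
map-proj₁-toList []         = refl
map-proj₁-toList (_ ∷ pxs)  = cong (_ ∷_) (map-proj₁-toList pxs)

theorem5p10 : (k : ℕ) → 1 ≤ k →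
    (n : ℕ) (T : Graph n) → IsTree T →
    (𝒯 : List (Graph n)) → All (LeafCuttable T) 𝒯 → Helly k 𝒯 →
    ∃[ E ] length E ≤ k ∸ 1 × All (_∈ᴱ T) E × All (λ Tᵢ → Any (_∈ᴱ Tᵢ) E) 𝒯
theorem5p10 k 1≤k n T tree 𝒯 cuttable helly =
    map topEdge picks
  , subst (_≤ k ∸ 1) (sym (length-map topEdge picks))
      (<⇒≤pred (disjoint⇒<k helly picks⊆𝒯 disjoint))
  , All.map⁺ (All.universal (λ (_ , t) → proj₂ (Top.sub t) (proj₁ (Top.top t))) picks)
  , subst (All _) (map-proj₁-toList tops) (All.map⁺ (All.map Any.map⁺ hit))
  where
  rooted = pendant-rooting T tree
  open Rooted {G = T} (proj₁ (proj₂ rooted)) (proj₂ (proj₂ rooted))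
  tops = All.map leafCuttable⇒Top cuttable
  open HittingPacking (sortedHittingPacking (All.toList tops))
  picks⊆𝒯 : All (λ t → proj₁ t ∈ˡ 𝒯) picks
  picks⊆𝒯 = All.map (λ t∈ → subst (_ ∈ˡ_) (map-proj₁-toList tops) (∈-map⁺ proj₁ t∈)) picks⊆
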